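{- For every sufficiently large natural number $n$ and every natural number $\alpha$, there exists a set $B \subseteq \{0,1\}^n$ with $|B| \leq (2n^{13} + n^{12})\cdot 2^{\alpha}$ such that every string $y \in \{0,1\}^n$ is $\alpha$-dependent with some string $x \in B$.
   Context: $C(x)$ denotes the plain Kolmogorov complexity of the binary string $x$ with respect to a fixed universal Turing machine; $C(x \mid y)$ denotes the conditional plain Kolmogorov complexity of $x$ given $y$ with respect to a fixed universal conditional machine. A string $y$ is said to have $\alpha$-dependency with (be $\alpha$-dependent with) a string $x$ if $C(y) - C(y \mid x) \geq \alpha$ or $x = y$. -}

module Defs where

open import Data.Bool using (Bool)
open import Data.Fin using (Fin; zero)
open import Data.List using (List; []; _∷_; length)
open import Data.Maybe using (Maybe; just; nothing)
open import Data.Nat using (ℕ; suc; _+_; _≤_)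
open import Data.Product using (_×_; _,_; ∃-syntax)
open import Data.Sum using (_⊎_)
open import Data.Vec using (Vec; []; _∷_; _++_; map; replicate; zipWith)
open import Relation.Binary.PropositionalEquality using (_≡_)

Word : Set
Word = List Bool

data Symbol (g : ℕ) : Set where
  blank : Symbol g
  bit   : Bool → Symbol g
  aux   : Fin g → Symbol g

data Move : Set where
  left stay right : Move

-- A two-way infinite tape with all but finitely many cells blank.  The list
-- before the head is stored nearest cell first; cells beyond either list are
-- blank.
record Tape (g : ℕ) : Set where
  constructor tape
  field
    before : List (Symbol g)
    scan   : Symbol g
    after  : List (Symbol g)

open Tape public

module _ {g : ℕ} where

  fromCells : List (Symbol g) → Tape g
  fromCells []       = tape [] blank []
  fromCells (s ∷ ss) = tape [] s ss

  -- The head starts on the first letter of the word.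
  load : Word → Tape g
  load w = fromCells (Data.List.map bit w)

  move : Move → Tape g → Tape g
  move left  (tape []       s rs)       = tape [] blank (s ∷ rs)
  move left  (tape (l ∷ ls) s rs)       = tape ls l (s ∷ rs)
  move stay  t                          = t
  move right (tape ls       s [])       = tape (s ∷ ls) blank []
  move right (tape ls       s (r ∷ rs)) = tape (s ∷ ls) r rs

  act : Symbol g × Move → Tape g → Tape g
  act (s , m) t = move m (record t { scan = s })

  bits : List (Symbol g) → Word
  bits (bit b ∷ ss) = b ∷ bits ss
  bits _            = []

  -- The longest block of bits starting at the head and extending rightwards.
  contents : Tape g → Word
  contents t = bits (scan t ∷ after t)

-- Deterministic multitape Turing machines with m input tapes.  The machine
-- halts when the transition function is undefined.
record TuringMachine (m : ℕ) : Set where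
  field
    auxSymbols : ℕ
    workTapes  : ℕ
    states     : ℕ

  Γ : Set
  Γ = Symbol auxSymbols

  State : Set
  State = Fin (suc states)

  tapes : ℕ
  tapes = m + workTapes

  field
    δ : State → Vec Γ tapes → Maybe (State × Vec (Γ × Move) tapes)

  Config : Set
  Config = State × Vec (Tape auxSymbols) tapes

  step : Config → Maybe Config
  step (q , ts) with δ q (map scan ts)
  ... | nothing        = nothing
  ... | just (q′ , as) = just (q′ , zipWith act as ts)

  initial : Vec Word m → Config
  initial ws = zero , map load ws ++ replicate workTapes (load [])

  data _↠_ : Config → Config → Set where
    halt : ∀ {c} → step c ≡ nothing → c ↠ c
    next : ∀ {c c′ d} → step c ≡ just c′ → c′ ↠ d → c ↠ d

-- The result of a halting computation is read off the first tape.
_⟨_⟩⇓_ : ∀ {m} → TuringMachine (suc m) → Vec Word (suc m) → Word → Set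
M ⟨ ws ⟩⇓ x = ∃[ q ] ∃[ t ] ∃[ ts ] (initial ws ↠ (q , t ∷ ts)) × contents t ≡ x
  where open TuringMachine M

-- In all that follows the first input is the program and the remaining m
-- inputs are the condition: m = 0 gives plain complexity, m = 1 conditional.

-- Additive optimality: C_U(x | ys) ≤ C_M(x | ys) + c for all x and ys, where
-- the complexity of a word without a program is infinite.
Universal : ∀ {m} → TuringMachine (suc m) → Set
Universal {m} U =
  (M : TuringMachine (suc m)) →
  ∃[ c ] ∀ (p : Word) (ys : Vec Word m) (x : Word) → M ⟨ p ∷ ys ⟩⇓ x →
  ∃[ q ] U ⟨ q ∷ ys ⟩⇓ x × length q ≤ length p + c

-- C[ M ] x ∣ ys ≈ k says that k is the least length of a program for x given
-- ys.  It is a relation because the least length is not computable.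
C[_]_∣_≈_ : ∀ {m} → TuringMachine (suc m) → Word → Vec Word m → ℕ → Set
C[ M ] x ∣ ys ≈ k =
  (∃[ p ] length p ≡ k × M ⟨ p ∷ ys ⟩⇓ x) ×
  (∀ p → M ⟨ p ∷ ys ⟩⇓ x → k ≤ length p)

-- The inequality C(y) - C(y | x) ≥ α is between integers, so it must not be
-- written with truncated subtraction.
Dependent : TuringMachine 1 → TuringMachine 2 → ℕ → Word → Word → Set
Dependent U V α y x =
  (∃[ k ] ∃[ l ] C[ U ] y ∣ [] ≈ k × C[ V ] y ∣ (x ∷ []) ≈ l × α + l ≤ k)
  ⊎ x ≡ y

-- Let V simulate, at an additive cost c, the machine that from a program p and
-- a condition 0…01r runs U on the concatenation of the reversal of r and p.
-- Put K = α + c.  If the shortest program of y has k > K bits, then its first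
-- K bits, reversed and padded to length n, form a string x given which the
-- remaining k - K bits describe y, so C(y | x) ≤ k - K + c = C(y) - α.  There
-- are 2^K such strings x.  The strings y with C(y) ≤ K number less than
-- 2^(K+1) and are put into B themselves, and so are all strings of length n if
-- n ≤ K, when there is no room for the padding.
module Submission where

open import Axiom.ExcludedMiddle using (ExcludedMiddle)
open import Data.Bool using (Bool; true; false)
import Data.Bool.Properties as Bool
open import Data.Fin using (Fin; zero; suc)
open import Data.List using (List; []; _∷_; length; deduplicate; drop; mapMaybe; reverse; take; _ʳ++_)
  renaming (_++_ to _++ₗ_; map to mapₗ; replicate to replicateₗ)
open import Data.List.Membership.Propositional using (_∈_)
open import Data.List.Membership.Propositional.Properties
  using (∈-++⁺ˡ; ∈-++⁺ʳ; ∈-deduplicate⁺; ∈-map⁺)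
open import Data.List.Properties
  using ( length-++; length-drop; length-filter; length-map; length-mapMaybe; length-replicate
        ; length-reverse; length-take; reverse-involutive; take++drop≡id; ʳ++-defn)
open import Data.List.Relation.Unary.Any as Any using (here; there)
import Data.List.Relation.Unary.Any.Properties as Any
open import Data.List.Relation.Unary.Unique.Propositional using (Unique)
open import Data.List.Relation.Unary.Unique.DecPropositional.Properties using (deduplicate-!)
open import Data.Maybe as Maybe using (Maybe; just; nothing)
import Data.Maybe.Relation.Unary.Any as MAny
open import Data.Maybe.Properties using (just-injective)
open import Data.Nat
  using (ℕ; zero; suc; _+_; _∸_; _*_; _^_; _≤_; _<_; z≤n; s≤s; _≤?_; NonZero; >-nonZero)
open import Data.Nat.Properties
open import Data.Nat.Tactic.RingSolver using (solve-∀)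
open import Data.Product using (_×_; _,_; proj₂; Σ-syntax; ∃-syntax)
open import Data.Sum using (inj₁; inj₂)
open import Data.Vec using (Vec; []; _∷_; fromList; map; replicate; toList; zipWith)
open import Data.Vec.Properties as Vec using (length-toList; toList∘fromList)
open import Level using (0ℓ)
open import Relation.Binary.Definitions using (DecidableEquality)
open import Relation.Binary.PropositionalEquality
  using (_≡_; refl; sym; trans; cong; cong₂; subst; module ≡-Reasoning)
open import Relation.Nullary using (¬?; contradiction; yes; no)
open import Defs

-- Determinism of runs, and the identity machine.

bits-map-bit : ∀ {g} w → bits {g} (mapₗ bit w) ≡ w
bits-map-bit []      = refl
bits-map-bit (b ∷ w) = cong (b ∷_) (bits-map-bit w)

contents-load : ∀ {g} w → contents {g} (load w) ≡ w
contents-load []      = refl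
contents-load (b ∷ w) = cong (b ∷_) (bits-map-bit w)

module _ {m : ℕ} (M : TuringMachine m) where
  open TuringMachine M

  ↠-deterministic : ∀ {c d e} → c ↠ d → c ↠ e → d ≡ e
  ↠-deterministic (halt _)      (halt _)      = refl
  ↠-deterministic (halt p)      (next q _)    = contradiction (trans (sym p) q) λ ()
  ↠-deterministic (next p _)    (halt q)      = contradiction (trans (sym q) p) λ ()
  ↠-deterministic (next p c↠d)  (next q c↠e)
    with refl ← just-injective (trans (sym p) q) = ↠-deterministic c↠d c↠e

⇓-deterministic : ∀ {m} (M : TuringMachine (suc m)) {ws x y} →
  M ⟨ ws ⟩⇓ x → M ⟨ ws ⟩⇓ y → x ≡ y
⇓-deterministic M (_ , _ , _ , run , refl) (_ , _ , _ , run′ , refl)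
  with refl ← ↠-deterministic M run run′ = refl

-- It halts at once, so every word is its own program. Optimality of a universal machine against it
-- gives every string some program.
identityMachine : ∀ m → TuringMachine m
identityMachine m = record
  { auxSymbols = 0 ; workTapes = 0 ; states = 0 ; δ = λ _ _ → nothing }

identityMachine-⇓ : ∀ {m} w (ws : Vec Word m) → identityMachine (suc m) ⟨ w ∷ ws ⟩⇓ w
identityMachine-⇓ {m} w ws = _ , _ , _ , halt refl , contents-load w
  where open TuringMachine (identityMachine (suc m))

-- A machine that puts the reversed condition in front of the program.

module _ {g : ℕ} where

  -- The shape of a tape after a move to the right, uniform in whether the head has run past the
  -- last cell.
  focus : List (Symbol g) → List (Symbol g) → Tape g
  focus ls []       = tape ls blank []
  focus ls (s ∷ rs) = tape ls s rs

  move-right : ∀ ls s rs → move right (tape ls s rs) ≡ focus (s ∷ ls) rs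
  move-right ls s []       = refl
  move-right ls s (r ∷ rs) = refl

  fromCells-focus : ∀ ss → fromCells ss ≡ focus [] ss
  fromCells-focus []       = refl
  fromCells-focus (_ ∷ _)  = refl

  idle : ∀ {n} → Vec (Symbol g) n → Vec (Symbol g × Move) n
  idle = map (_, stay)

  zipWith-act-idle : ∀ {n} (ts : Vec (Tape g) n) → zipWith act (idle (map scan ts)) ts ≡ ts
  zipWith-act-idle []       = refl
  zipWith-act-idle (t ∷ ts) = cong (t ∷_) (zipWith-act-idle ts)

module Prepend (U : TuringMachine 1) where
  private module U = TuringMachine U

  -- `skipping` passes the padding up to the first true bit. Copying one bit takes two steps, since
  -- a step writes before it moves: `reading` moves the program head left to a fresh cell, and
  -- `writing` fills that cell. `running q` is state `q` of `U`.
  pattern skipping = zero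
  pattern reading  = suc zero
  pattern writing  = suc (suc zero)
  pattern running q = suc (suc (suc q))

  -- No cell of the program tape is ever visited before it is written, so that
  -- at the end of the copying phase the tape is literally a loaded tape, without
  -- extra blanks, provided that the program is not empty.
  δ : Fin (4 + U.states) → Vec U.Γ (2 + U.workTapes) →
      Maybe (Fin (4 + U.states) × Vec (U.Γ × Move) (2 + U.workTapes))
  δ skipping    (s ∷ bit false ∷ ss) = just (skipping , (s , stay) ∷ (bit false , right) ∷ idle ss)
  δ skipping    (s ∷ bit true  ∷ ss) = just (reading , (s , stay) ∷ (bit true , right) ∷ idle ss)
  δ skipping    _                    = nothing
  δ reading     (s ∷ bit b ∷ ss)     = just (writing , (s , left) ∷ (bit b , stay) ∷ idle ss)
  δ reading     (s ∷ r ∷ ss)         = just (running zero , (s , stay) ∷ (r , stay) ∷ idle ss)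
  δ writing     (s ∷ r ∷ ss)         = just (reading , (r , stay) ∷ (r , right) ∷ idle ss)
  δ (running q) (s ∷ r ∷ ss)         =
    Maybe.map (λ { (q′ , a ∷ as) → running q′ , a ∷ (r , stay) ∷ as }) (U.δ q (s ∷ ss))

  machine : TuringMachine 2
  machine = record
    { auxSymbols = U.auxSymbols ; workTapes = U.workTapes ; states = 3 + U.states ; δ = δ }

  open TuringMachine machine hiding (δ)

  embed : Tape U.auxSymbols → U.Config → Config
  embed x (q , t ∷ ts) = running q , t ∷ x ∷ ts

  -- In a running state the condition tape gets back the symbol just scanned and its head stays, so
  -- `x` never changes.
  step-embed : ∀ x c → step (embed x c) ≡ Maybe.map (embed x) (U.step c)
  step-embed x (q , t ∷ ts) with U.δ q (scan t ∷ map scan ts)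
  ... | nothing            = refl
  ... | just (q′ , a ∷ as) = refl

  simulate : ∀ x {c d} → c U.↠ d → embed x c ↠ embed x d
  simulate x {c} (U.halt p)   = halt (trans (step-embed x c) (cong (Maybe.map (embed x)) p))
  simulate x {c} (U.next p r) =
    next (trans (step-embed x c) (cong (Maybe.map (embed x)) p)) (simulate x r)

  -- Halting with a given result from any configuration, so that inductions can start in the middle
  -- of a run.
  HaltsWith : Config → Word → Set
  HaltsWith c y = ∃[ q ] ∃[ t ] ∃[ ts ] (c ↠ (q , t ∷ ts)) × contents t ≡ y

  after-step : ∀ {c c′ y} → step c ≡ just c′ → HaltsWith c′ y → HaltsWith c y
  after-step p (q , t , ts , run , eq) = q , t , ts , next p run , eq

  module _ (ts : Vec (Tape U.auxSymbols) U.workTapes) {y : Word} where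

    -- Each bit read is pushed in front of the program, hence the reversal. The hypothesis
    -- quantifies over `x` because the simulation of `U` ignores what is left on the condition tape.
    copy : ∀ r ls b w → (∀ x → HaltsWith (running zero , load (r ʳ++ b ∷ w) ∷ x ∷ ts) y) →
      HaltsWith (reading , load (b ∷ w) ∷ focus ls (mapₗ bit r) ∷ ts) y
    copy []      ls b w run =
      after-step (cong (λ us → just (_ , _ ∷ _ ∷ us)) (zipWith-act-idle ts)) (run _)
    copy (a ∷ r) ls b w run =
      after-step (cong (λ us → just (_ , _ ∷ _ ∷ us)) (zipWith-act-idle ts))
      (after-step (cong₂ (λ x us → just (_ , _ ∷ x ∷ us)) (move-right ls (bit a) _) (zipWith-act-idle ts))
      (copy r (bit a ∷ ls) a (b ∷ w) run))

    skip : ∀ m r ls b w → (∀ x → HaltsWith (running zero , load (r ʳ++ b ∷ w) ∷ x ∷ ts) y) →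
      HaltsWith (skipping , load (b ∷ w) ∷ focus ls (mapₗ bit (replicateₗ m false ++ₗ true ∷ r)) ∷ ts) y
    skip zero    r ls b w run =
      after-step (cong₂ (λ x us → just (_ , _ ∷ x ∷ us)) (move-right ls (bit true) _) (zipWith-act-idle ts))
      (copy r (bit true ∷ ls) b w run)
    skip (suc m) r ls b w run =
      after-step (cong₂ (λ x us → just (_ , _ ∷ x ∷ us)) (move-right ls (bit false) _) (zipWith-act-idle ts))
      (skip m r (bit false ∷ ls) b w run)

  -- The number `m` of padding bits is free, which lets conditions be padded to any prescribed
  -- greater length.
  machine-⇓ : ∀ m r b w {y} → U ⟨ (r ʳ++ b ∷ w) ∷ [] ⟩⇓ y →
    machine ⟨ (b ∷ w) ∷ (replicateₗ m false ++ₗ true ∷ r) ∷ [] ⟩⇓ y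
  machine-⇓ m r b w {y} (q , t , ts , run , eq) =
    subst (λ x → HaltsWith (skipping , load (b ∷ w) ∷ x ∷ replicate _ (load [])) y)
      (sym (fromCells-focus (mapₗ bit (replicateₗ m false ++ₗ true ∷ r))))
      (skip _ m r [] b w λ x → running q , t , x ∷ ts , simulate x run , eq)

-- The prefix is reversed in advance, to be reversed back by the machine. Strictness of
-- `k < length p` keeps the remainder nonempty, as the copying phase demands.
split-reversed : ∀ k (p : Word) → k < length p →
  ∃[ r ] ∃[ b ] ∃[ w ] length r ≡ k × length (b ∷ w) ≡ length p ∸ k × r ʳ++ b ∷ w ≡ p
split-reversed k p k<p with drop k p in eq
... | []    = contradiction (trans (cong length (sym eq)) (length-drop k p)) (<⇒≢ (m<n⇒0<n∸m k<p))
... | b ∷ w = reverse (take k p) , b , w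
  , trans (length-reverse (take k p)) (trans (length-take k p) (m≤n⇒m⊓n≡m (<⇒≤ k<p)))
  , trans (cong length (sym eq)) (length-drop k p)
  , (begin
      reverse (take k p) ʳ++ b ∷ w           ≡⟨ ʳ++-defn (reverse (take k p)) ⟩
      reverse (reverse (take k p)) ++ₗ b ∷ w ≡⟨ cong₂ _++ₗ_ (reverse-involutive (take k p)) (sym eq) ⟩
      take k p ++ₗ drop k p                  ≡⟨ take++drop≡id k p ⟩
      p                                      ∎)
  where open ≡-Reasoning

-- Enumerating short words, selecting vectors, padding.

words≤ : ℕ → List Word
words≤ zero    = [] ∷ []
words≤ (suc k) = [] ∷ mapₗ (false ∷_) (words≤ k) ++ₗ mapₗ (true ∷_) (words≤ k)

-- With the `suc` there is no subtraction from the power, and the inductive step is a doubling.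
length-words≤ : ∀ k → suc (length (words≤ k)) ≡ 2 ^ suc k
length-words≤ zero    = refl
length-words≤ (suc k) = begin
  suc (suc (length (mapₗ (false ∷_) ws ++ₗ mapₗ (true ∷_) ws)))
    ≡⟨ cong (λ l → suc (suc l)) (length-++ (mapₗ (false ∷_) ws)) ⟩
  suc (suc (length (mapₗ (false ∷_) ws) + length (mapₗ (true ∷_) ws)))
    ≡⟨ cong₂ (λ l l′ → suc (suc (l + l′))) (length-map _ ws) (length-map _ ws) ⟩
  suc (suc (length ws + length ws))
    ≡⟨ cong suc (sym (+-suc (length ws) (length ws))) ⟩
  suc (length ws) + suc (length ws)
    ≡⟨ cong₂ _+_ (length-words≤ k) (trans (length-words≤ k) (sym (+-identityʳ (2 ^ suc k)))) ⟩
  2 ^ suc (suc k) ∎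
  where
  open ≡-Reasoning
  ws = words≤ k

∈-words≤ : ∀ {k} w → length w ≤ k → w ∈ words≤ k
∈-words≤ {zero}  []          _         = here refl
∈-words≤ {suc k} []          _         = here refl
∈-words≤ {suc k} (false ∷ w) (s≤s w≤k) = there (∈-++⁺ˡ (∈-map⁺ (false ∷_) (∈-words≤ w w≤k)))
∈-words≤ {suc k} (true ∷ w)  (s≤s w≤k) =
  there (∈-++⁺ʳ (mapₗ (false ∷_) (words≤ k)) (∈-map⁺ (true ∷_) (∈-words≤ w w≤k)))

toVec : ∀ {A : Set} n → List A → Maybe (Vec A n)
toVec zero    []       = just []
toVec (suc n) (x ∷ xs) = Maybe.map (x ∷_) (toVec n xs)
toVec _       _        = nothing

toVec∘toList : ∀ {A : Set} {n} (v : Vec A n) → toVec n (toList v) ≡ just v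
toVec∘toList []      = refl
toVec∘toList (x ∷ v) = cong (Maybe.map (x ∷_)) (toVec∘toList v)

∈-mapMaybe⁺ : ∀ {A B : Set} (f : A → Maybe B) {x y xs} → f x ≡ just y → x ∈ xs → y ∈ mapMaybe f xs
∈-mapMaybe⁺ f {y = y} {xs = xs} fx≡y x∈xs = Any.mapMaybe⁺ f xs
  (Any.map⁺ (Any.map (λ { refl → subst (MAny.Any (y ≡_)) (sym fx≡y) (MAny.just refl) }) x∈xs))

length-deduplicate : ∀ {A : Set} (_≟_ : DecidableEquality A) xs → length (deduplicate _≟_ xs) ≤ length xs
length-deduplicate _≟_ []       = z≤n
length-deduplicate _≟_ (x ∷ xs) = s≤s (≤-trans
  (length-filter (λ y → ¬? (x ≟ y)) (deduplicate _≟_ xs)) (length-deduplicate _≟_ xs))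

-- Candidates may have any length and may repeat. Discarding wrong lengths and duplicates only
-- shrinks the list, so it suffices to count words.
vectorsIn : ∀ n → List Word → List (Vec Bool n)
vectorsIn n ws = deduplicate (Vec.≡-dec Bool._≟_) (mapMaybe (toVec n) ws)

module _ {n : ℕ} (ws : List Word) where

  vectorsIn-unique : Unique (vectorsIn n ws)
  vectorsIn-unique = deduplicate-! (Vec.≡-dec Bool._≟_) (mapMaybe (toVec n) ws)

  length-vectorsIn : length (vectorsIn n ws) ≤ length ws
  length-vectorsIn = ≤-trans
    (length-deduplicate (Vec.≡-dec Bool._≟_) (mapMaybe (toVec n) ws)) (length-mapMaybe (toVec n) ws)

  ∈-vectorsIn : ∀ v → toList v ∈ ws → v ∈ vectorsIn n ws
  ∈-vectorsIn v v∈ws =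
    ∈-deduplicate⁺ (Vec.≡-dec Bool._≟_) (∈-mapMaybe⁺ (toVec n) (toVec∘toList v) v∈ws)

as-vector : ∀ {n} (w : Word) → length w ≡ n → ∃[ v ] toList {n = n} v ≡ w
as-vector w refl = fromList w , toList∘fromList w

-- The true bit marks where `r` begins and takes one place itself, so reaching length `n` requires
-- `length r < n`.
pad : ℕ → Word → Word
pad n r = replicateₗ (n ∸ suc (length r)) false ++ₗ true ∷ r

length-pad : ∀ {n} r → length r < n → length (pad n r) ≡ n
length-pad {n} r r<n = begin
  length (pad n r)                                          ≡⟨ length-++ (replicateₗ (n ∸ suc (length r)) false) ⟩
  length (replicateₗ (n ∸ suc (length r)) false) + suc (length r)
    ≡⟨ cong (_+ suc (length r)) (length-replicate (n ∸ suc (length r))) ⟩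
  n ∸ suc (length r) + suc (length r)                       ≡⟨ m∸n+n≡m r<n ⟩
  n                                                         ∎
  where open ≡-Reasoning

-- Complexities and outputs by excluded middle.

module _ (em : ExcludedMiddle 0ℓ) where

  -- `P` will be undecidable, so excluded middle settles `P` at zero; otherwise `P` is shifted by
  -- one, and the known witness `n` bounds the recursion.
  least : (P : ℕ → Set) → ∀ n → P n → ∃[ m ] P m × (∀ j → P j → m ≤ j)
  least P zero    Pn = zero , Pn , λ _ _ → z≤n
  least P (suc n) Pn with em {P zero}
  ... | yes P0 = zero , P0 , λ _ _ → z≤n
  ... | no ¬P0 with m , Pm , minimal ← least (λ j → P (suc j)) n Pn =
    suc m , Pm , λ { zero P0 → contradiction P0 ¬P0 ; (suc j) Pj → s≤s (minimal j Pj) }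

  complexity-exists : ∀ {m} (M : TuringMachine (suc m)) {p ys x} → M ⟨ p ∷ ys ⟩⇓ x → ∃[ k ] C[ M ] x ∣ ys ≈ k
  complexity-exists M {p} {ys} {x} run
    with k , shortest , minimal ← least (λ k → ∃[ p ] length p ≡ k × M ⟨ p ∷ ys ⟩⇓ x) (length p) (p , refl , run)
    = k , shortest , λ q run′ → minimal (length q) (q , refl , run′)

  output : ∀ {m} → TuringMachine (suc m) → Vec Word (suc m) → Word
  output M ws with em {∃[ x ] M ⟨ ws ⟩⇓ x}
  ... | yes (x , _) = x
  -- A default for programs without output; it can only add the empty word to the candidates.
  ... | no _        = []

  output-⇓ : ∀ {m} (M : TuringMachine (suc m)) {ws x} → M ⟨ ws ⟩⇓ x → output M ws ≡ x
  output-⇓ M {ws} {x} run with em {∃[ x ] M ⟨ ws ⟩⇓ x}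
  ... | yes (_ , run′) = ⇓-deterministic M run′ run
  ... | no ¬run        = contradiction (x , run) ¬run

  -- The candidates and the strings they dominate.

  module _ (U : TuringMachine 1) where

    -- The three blocks serve, in order, small `n`, strings of high complexity and strings of low
    -- complexity. One enumeration of the words of length at most `k` feeds all three.
    candidates : ℕ → ℕ → List Word
    candidates n k =
      words≤ k ++ₗ mapₗ (pad n) (words≤ k) ++ₗ mapₗ (λ p → output U (p ∷ [])) (words≤ k)

    length-candidates : ∀ n k → length (candidates n k) ≤ 2 ^ (3 + k)
    length-candidates n k = begin
      length (candidates n k)
        ≡⟨ length-++ ws ⟩
      length ws + length (mapₗ (pad n) ws ++ₗ mapₗ _ ws)
        ≡⟨ cong (length ws +_) (length-++ (mapₗ (pad n) ws)) ⟩
      length ws + (length (mapₗ (pad n) ws) + length (mapₗ _ ws))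
        ≡⟨ cong₂ (λ l l′ → length ws + (l + l′)) (length-map _ ws) (length-map _ ws) ⟩
      length ws + (length ws + length ws)
        ≤⟨ +-mono-≤ ws≤ (+-mono-≤ ws≤ ws≤) ⟩
      2 ^ suc k + (2 ^ suc k + 2 ^ suc k)
        -- A fourth copy rounds the bound up to a power of two.
        ≤⟨ +-monoʳ-≤ (2 ^ suc k) (m≤n+m _ (2 ^ suc k)) ⟩
      2 ^ suc k + (2 ^ suc k + (2 ^ suc k + 2 ^ suc k))
        ≡⟨ four (2 ^ suc k) ⟩
      2 ^ (3 + k) ∎
      where
      open ≤-Reasoning
      ws = words≤ k
      ws≤ : length ws ≤ 2 ^ suc k
      ws≤ = ≤-trans (n≤1+n _) (≤-reflexive (length-words≤ k))
      four : ∀ a → a + (a + (a + a)) ≡ 2 * (2 * a)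
      four = solve-∀

    module _ (V : TuringMachine 2) {c : ℕ}
      (V-simulates : ∀ p ys x → Prepend.machine U ⟨ p ∷ ys ⟩⇓ x →
                     ∃[ q ] V ⟨ q ∷ ys ⟩⇓ x × length q ≤ length p + c) where

      -- Here `p` is a shortest program of `y`. Moving its first `α + c` bits into the condition
      -- saves `α + c` bits, of which the simulation by `V` costs at most `c`.
      prefix-dependent : ∀ α n p {y} → α + c < length p → C[ U ] y ∣ [] ≈ length p → U ⟨ p ∷ [] ⟩⇓ y →
        ∃[ r ] length r ≡ α + c × Dependent U V α y (pad n r)
      prefix-dependent α n p K<p Cy run
        with r , b , w , r≡K , bw≡ , refl ← split-reversed (α + c) p K<p
        with q , Vq , q≤ ← V-simulates (b ∷ w) (pad n r ∷ []) _
               (Prepend.machine-⇓ U (n ∸ suc (length r)) r b w run)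
        with l , Cl ← complexity-exists V Vq
        = r , r≡K , inj₁ (_ , l , Cy , Cl , bound)
        where
        open ≤-Reasoning
        -- Matching on `refl` has replaced `p` by this word, so `k` is the complexity of `y`.
        k = length (r ʳ++ b ∷ w)
        bound : α + l ≤ k
        bound = begin
          α + l                       ≤⟨ +-monoʳ-≤ α (proj₂ Cl q Vq) ⟩
          α + length q                ≤⟨ +-monoʳ-≤ α q≤ ⟩
          α + (length (b ∷ w) + c)    ≡⟨ cong (λ j → α + (j + c)) bw≡ ⟩
          α + (k ∸ (α + c) + c)       ≡⟨ cong (α +_) (+-comm _ c) ⟩
          α + (c + (k ∸ (α + c)))     ≡⟨ +-assoc α c _ ⟨
          α + c + (k ∸ (α + c))       ≡⟨ m+[n∸m]≡n (<⇒≤ K<p) ⟩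
          k                           ∎

      candidates-dominate : ∀ α n (y : Vec Bool n) {p} → U ⟨ p ∷ [] ⟩⇓ toList y →
        ∃[ x ] x ∈ vectorsIn n (candidates n (α + c)) × Dependent U V α (toList y) (toList x)
      candidates-dominate α n y run
        -- The given program only shows that the complexity exists; from here on `p` is a shortest
        -- one.
        with k , Cy@((p , refl , Up) , _) ← complexity-exists U run
        with n ≤? α + c | length p ≤? α + c
      ... | yes n≤K | _       =
        y , ∈-vectorsIn W y (∈-++⁺ˡ (∈-words≤ (toList y) (≤-trans (≤-reflexive (length-toList y)) n≤K)))
          , inj₂ refl
        where W = candidates n (α + c)
      ... | no _    | yes p≤K =
        y , ∈-vectorsIn W y (∈-++⁺ʳ (words≤ K) (∈-++⁺ʳ (mapₗ (pad n) (words≤ K)) y∈outputs)) , inj₂ refl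
        where
        K = α + c
        W = candidates n K
        y∈outputs : toList y ∈ mapₗ (λ p → output U (p ∷ [])) (words≤ K)
        y∈outputs = subst (_∈ _) (output-⇓ U Up) (∈-map⁺ (λ p → output U (p ∷ [])) (∈-words≤ p p≤K))
      ... | no n≰K  | no p≰K
        with r , r≡K , dependent ← prefix-dependent α n p (≰⇒> p≰K) Cy Up
        -- Since `r` has exactly `K` bits and `K < n`, there is room for the marker bit.
        with x , x≡ ← as-vector (pad n r) (length-pad r (≤-<-trans (≤-reflexive r≡K) (≰⇒> n≰K)))
        = x , ∈-vectorsIn W x (subst (_∈ W) (sym x≡) pad∈W)
            , subst (Dependent U V α (toList y)) (sym x≡) dependent
        where
        K = α + c
        W = candidates n K
        pad∈W : pad n r ∈ W
        pad∈W = ∈-++⁺ʳ (words≤ K) (∈-++⁺ˡ (∈-map⁺ (pad n) (∈-words≤ r (≤-reflexive r≡K))))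

theorem6 : ExcludedMiddle 0ℓ →
    (U : TuringMachine 1) (V : TuringMachine 2) → Universal U → Universal V →
    ∃[ n₀ ] ∀ (n : ℕ) → n₀ ≤ n → ∀ (α : ℕ) →
    Σ[ B ∈ List (Vec Bool n) ]
    Unique B ×
    length B ≤ (2 * n ^ 13 + n ^ 12) * 2 ^ α ×
    (∀ (y : Vec Bool n) → ∃[ x ] x ∈ B × Dependent U V α (toList y) (toList x))
theorem6 em U V U-universal V-universal
  with _ , U-describes ← U-universal (identityMachine 1)
  with c , V-simulates ← V-universal (Prepend.machine U) =
  -- The candidates number at most `2 ^ (3 + c)` times `2 ^ α`, and from this threshold on `n`
  -- absorbs the constant factor.
  2 ^ (3 + c) , λ n n₀≤n α →
    let W = candidates em U n (α + c) in
    vectorsIn n W , vectorsIn-unique W , size n n₀≤n α ,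
    λ y → let _ , run , _ = U-describes (toList y) [] (toList y) (identityMachine-⇓ (toList y) [])
          in candidates-dominate em U V V-simulates α n y run
  where
  open ≤-Reasoning
  size : ∀ n → 2 ^ (3 + c) ≤ n → ∀ α →
    length (vectorsIn n (candidates em U n (α + c))) ≤ (2 * n ^ 13 + n ^ 12) * 2 ^ α
  size n n₀≤n α = begin
    length (vectorsIn n (candidates em U n (α + c))) ≤⟨ length-vectorsIn (candidates em U n (α + c)) ⟩
    length (candidates em U n (α + c))               ≤⟨ length-candidates em U n (α + c) ⟩
    2 ^ (3 + (α + c))             ≡⟨ cong (λ j → 2 ^ (3 + j)) (+-comm α c) ⟩
    2 ^ (3 + c + α)               ≡⟨ ^-distribˡ-+-* 2 (3 + c) α ⟩
    2 ^ (3 + c) * 2 ^ α           ≤⟨ *-monoˡ-≤ (2 ^ α) n₀≤n ⟩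
    -- `n * n ^ 11` is `n ^ 12` by definition; `n` is positive because it is at least a power of
    -- two.
    n * 2 ^ α                     ≤⟨ *-monoˡ-≤ (2 ^ α) (m≤m*n n (n ^ 11)) ⟩
    n ^ 12 * 2 ^ α                ≤⟨ *-monoˡ-≤ (2 ^ α) (m≤n+m (n ^ 12) (2 * n ^ 13)) ⟩
    (2 * n ^ 13 + n ^ 12) * 2 ^ α ∎
    where
    instance
      n≢0 : NonZero n
      n≢0 = >-nonZero (≤-trans (m^n>0 2 (3 + c)) n₀≤n)
      n^11≢0 : NonZero (n ^ 11)
      n^11≢0 = m^n≢0 n 11
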